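{- For a Dyck path $D$ of length $2(n+1)$, let $(a_1,b_1),\dots,(a_k,b_k)$ be the peaks of $D$ of height at least $2$, listed from left to right, and set $p_i=(a_i+b_i-2)/2$, $r_i=b_i-1$. Define $\Phi(D)$ to be the word $R_1R_2\cdots R_k$ with $R_i=x_{p_i}x_{p_i-1}\cdots x_{p_i-r_i+1}$ (and $\Phi(D)=1$ if $k=0$). Then $\Phi$ is a bijection from the set of Dyck paths of length $2(n+1)$ to the set of nTL-monomials for $P_n$; moreover the decreasing runs of $\Phi(D)$ are exactly $R_1,\dots,R_k$.
   Context: Fix $n\ge 0$. The nil-Temperley-Lieb algebra $A_n$ of the path graph $P_n$ is the unital associative algebra generated by $x_1,\dots,x_n$ subject to the relations $x_i^2=0$; $x_ix_j=x_jx_i$ if $|i-j|>1$; $x_ix_{i+1}x_i=0$ and $x_{i+1}x_ix_{i+1}=0$ for $1\le i<n$. A word is a finite product of generators. Two words are equivalent if one can be obtained from the other by repeatedly swapping adjacent letters $x_ix_j\to x_jx_i$ with $|i-j|>1$. A word is reducible if it equals $0$ in $A_n$. Words of the same length are compared lexicographically by index sequences. An nTL-monomial is a word that is not reducible and lexicographically smallest among all words equivalent to it. A decreasing run is a maximal block of consecutive letters with strictly decreasing indices. A Dyck path of length $2m$ is a lattice path from $(0,0)$ to $(2m,0)$ with steps $(1,1)$ (up) and $(1,-1)$ (down) that never goes below the $x$-axis. A peak of a Dyck path is a point $(a,b)$ on it reached by an up step and followed by a down step; $b$ is its height. -}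

module Defs where

open import Algebra.Bundles using (CommutativeRing; Ring)
open import Data.Fin.Base as Fin using (Fin; toℕ; fromℕ<)
open import Data.Fin.Properties using (toℕ<n)
open import Data.List.Base using (List; []; _∷_; _++_; concat; filter; tabulate)
open import Data.List.Relation.Binary.Lex.Strict using (Lex-≤)
open import Data.List.Relation.Unary.All using (All; []; _∷_; reduce)
open import Data.List.Relation.Unary.All.Properties using (filter⁺)
open import Data.List.Relation.Unary.Linked using (Linked)
open import Data.Nat.Base using (ℕ; zero; suc; _+_; _*_; _∸_; ∣_-_∣; _≤_; _<_; z≤n; s≤s)
open import Data.Nat.DivMod using (_/_; /-monoˡ-≤; m*n/n≡m)
open import Data.Nat.Properties
  using (_≤?_; ≤-trans; ≤-reflexive; n≤1+n; m≤n+m; m∸n≤m; m<n⇒0<n∸m; +-identityʳ; +-suc;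
         +-mono-≤; +-monoˡ-≤; ∸-monoˡ-≤; *-comm; *-suc; *-distribˡ-∸; module ≤-Reasoning)
open import Data.Product.Base using (Σ; _×_; _,_)
open import Level using (_⊔_)
open import Relation.Binary.Construct.Closure.ReflexiveTransitive using (Star)
open import Relation.Binary.PropositionalEquality using (_≡_; _≢_; subst; cong; trans; sym)
open import Relation.Nullary.Negation.Core using (¬_)

-- The element i : Fin n stands for the generator with index toℕ i + 1.

Word : ℕ → Set
Word n = List (Fin n)

Far : ∀ {n} → Fin n → Fin n → Set
Far i j = 1 < ∣ toℕ i - toℕ j ∣

-- The K-algebra presented by the generators and relations of the path graph:
-- formal expressions modulo the smallest congruence that contains the axioms of
-- a unital associative K-algebra and the defining relations.

module NilTemperleyLieb {c ℓ} (K : CommutativeRing c ℓ) (n : ℕ) where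

  private module K = CommutativeRing K

  infixl 6 _⊕_
  infixl 7 _⊗_
  infix  8 ⊖_
  infix  4 _≈_

  data Expr : Set c where
    x       : Fin n → Expr
    const   : K.Carrier → Expr
    _⊕_ _⊗_ : Expr → Expr → Expr
    ⊖_      : Expr → Expr

  𝟘 𝟙 : Expr
  𝟘 = const K.0#
  𝟙 = const K.1#

  data _≈_ : Expr → Expr → Set (c ⊔ ℓ) where
    ≈-refl  : ∀ {e} → e ≈ e
    ≈-sym   : ∀ {e f} → e ≈ f → f ≈ e
    ≈-trans : ∀ {e f g} → e ≈ f → f ≈ g → e ≈ g

    ⊕-cong : ∀ {e e′ f f′} → e ≈ e′ → f ≈ f′ → e ⊕ f ≈ e′ ⊕ f′
    ⊗-cong : ∀ {e e′ f f′} → e ≈ e′ → f ≈ f′ → e ⊗ f ≈ e′ ⊗ f′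
    ⊖-cong : ∀ {e e′} → e ≈ e′ → ⊖ e ≈ ⊖ e′

    ⊕-assoc     : ∀ e f g → (e ⊕ f) ⊕ g ≈ e ⊕ (f ⊕ g)
    ⊕-comm      : ∀ e f → e ⊕ f ≈ f ⊕ e
    ⊕-identityˡ : ∀ e → 𝟘 ⊕ e ≈ e
    ⊕-inverseˡ  : ∀ e → (⊖ e) ⊕ e ≈ 𝟘
    ⊗-assoc     : ∀ e f g → (e ⊗ f) ⊗ g ≈ e ⊗ (f ⊗ g)
    ⊗-identityˡ : ∀ e → 𝟙 ⊗ e ≈ e
    ⊗-identityʳ : ∀ e → e ⊗ 𝟙 ≈ e
    ⊗-distribˡ  : ∀ e f g → e ⊗ (f ⊕ g) ≈ (e ⊗ f) ⊕ (e ⊗ g)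
    ⊗-distribʳ  : ∀ e f g → (f ⊕ g) ⊗ e ≈ (f ⊗ e) ⊕ (g ⊗ e)

    -- const is a ring homomorphism from K into the centre
    const-cong    : ∀ {k l} → k K.≈ l → const k ≈ const l
    const-+       : ∀ k l → const (k K.+ l) ≈ const k ⊕ const l
    const-*       : ∀ k l → const (k K.* l) ≈ const k ⊗ const l
    const-central : ∀ k e → const k ⊗ e ≈ e ⊗ const k

    x-square  : ∀ i → x i ⊗ x i ≈ 𝟘
    x-commute : ∀ {i j} → Far i j → x i ⊗ x j ≈ x j ⊗ x i
    x-braid   : ∀ {i j} → toℕ j ≡ suc (toℕ i) → x i ⊗ x j ⊗ x i ≈ 𝟘
    x-braid′  : ∀ {i j} → toℕ j ≡ suc (toℕ i) → x j ⊗ x i ⊗ x j ≈ 𝟘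

  algebra : Ring c (c ⊔ ℓ)
  algebra = record
    { Carrier = Expr ; _≈_ = _≈_ ; _+_ = _⊕_ ; _*_ = _⊗_ ; -_ = ⊖_ ; 0# = 𝟘 ; 1# = 𝟙
    ; isRing = record
      { +-isAbelianGroup = record
        { isGroup = record
          { isMonoid = record
            { isSemigroup = record
              { isMagma = record
                { isEquivalence = record { refl = ≈-refl ; sym = ≈-sym ; trans = ≈-trans }
                ; ∙-cong = ⊕-cong
                }
              ; assoc = ⊕-assoc
              }
            ; identity = ⊕-identityˡ , λ e → ≈-trans (⊕-comm e 𝟘) (⊕-identityˡ e)
            }
          ; inverse = ⊕-inverseˡ , λ e → ≈-trans (⊕-comm e (⊖ e)) (⊕-inverseˡ e)
          ; ⁻¹-cong = ⊖-cong
          }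
        ; comm = ⊕-comm
        }
      ; *-cong = ⊗-cong
      ; *-assoc = ⊗-assoc
      ; *-identity = ⊗-identityˡ , ⊗-identityʳ
      ; distrib = ⊗-distribˡ , ⊗-distribʳ
      }
    }

  ⟦_⟧ : Word n → Expr
  ⟦ []    ⟧ = 𝟙
  ⟦ i ∷ w ⟧ = x i ⊗ ⟦ w ⟧

  Reducible : Word n → Set (c ⊔ ℓ)
  Reducible w = ⟦ w ⟧ ≈ 𝟘

data Swap {n : ℕ} : Word n → Word n → Set where
  swap : ∀ u {i j} v → Far i j → Swap (u ++ i ∷ j ∷ v) (u ++ j ∷ i ∷ v)

Equivalent : ∀ {n} → Word n → Word n → Set
Equivalent = Star Swap

-- Only applied to words of equal length.
_≤lex_ : ∀ {n} → Word n → Word n → Set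
_≤lex_ = Lex-≤ _≡_ Fin._<_

record IsNTLMonomial {c ℓ} (K : CommutativeRing c ℓ) (n : ℕ) (w : Word n) : Set (c ⊔ ℓ) where
  field
    irreducible : ¬ NilTemperleyLieb.Reducible K n w
    minimal     : ∀ v → Equivalent w v → w ≤lex v

NTLMonomial : ∀ {c ℓ} → CommutativeRing c ℓ → ℕ → Set (c ⊔ ℓ)
NTLMonomial K n = Σ (Word n) (IsNTLMonomial K n)

Decreasing : ∀ {n} → Word n → Set
Decreasing = Linked Fin._>_

-- The occurrence of the block b in w = u ++ b ++ v is a decreasing run.
record IsDecreasingRun {n} (w u b v : Word n) : Set where
  field
    factor     : u ++ b ++ v ≡ w
    nonempty   : b ≢ []
    decreasing : Decreasing b
    maximal    : ∀ u′ s t v′ → u ≡ u′ ++ s → v ≡ t ++ v′ → Decreasing (s ++ b ++ t) →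
                 s ≡ [] × t ≡ []

-- Path L a b: lattice paths from (a , b) to (L , 0); heights are natural numbers,
-- so such a path never goes below the x-axis.
data Path (L : ℕ) : ℕ → ℕ → Set where
  end  : Path L L 0
  up   : ∀ {a b} → Path L (suc a) (suc b) → Path L a b
  down : ∀ {a b} → Path L (suc a) b → Path L a (suc b)

DyckPath : ℕ → Set
DyckPath m = Path (2 * m) 0 0

peaks : ∀ {L a b} → Path L a b → List (ℕ × ℕ)
peaks end                      = []
peaks {a = a} {b} (up (down p)) = (suc a , suc b) ∷ peaks p
peaks (up (up p))              = peaks (up p)
peaks (down p)                 = peaks p

highPeaks : ∀ {L a b} → Path L a b → List (ℕ × ℕ)
highPeaks p = filter (λ (_ , b) → 2 ≤? b) (peaks p)

-- The bounds on peaks that keep the letters of Φ within x₁ , … , xₙ.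

Bounded : ℕ → ℕ × ℕ → Set
Bounded L (a , b) = b ≤ a × a + b ≤ L

path-bound : ∀ {L a b} → Path L a b → a + b ≤ L
path-bound {L} end              = ≤-reflexive (+-identityʳ L)
path-bound {L} {a} {b} (up p)   = ≤-trans (+-mono-≤ (n≤1+n a) (n≤1+n b)) (path-bound p)
path-bound {L} {a} (down {b = b} p) = subst (_≤ L) (sym (+-suc a b)) (path-bound p)

peaks-bounded : ∀ {L a b} → b ≤ a → (p : Path L a b) → All (Bounded L) (peaks p)
peaks-bounded b≤a end           = []
peaks-bounded b≤a (up (down p)) =
  (s≤s b≤a , path-bound (down p)) ∷ peaks-bounded (≤-trans b≤a (m≤n+m _ 2)) p
peaks-bounded b≤a (up (up p))   = peaks-bounded (s≤s b≤a) (up p)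
peaks-bounded b<a (down p)      = peaks-bounded (≤-trans (n≤1+n _) (≤-trans b<a (n≤1+n _))) p

highPeaks-bounded : ∀ {L} (D : Path L 0 0) → All (Bounded L) (highPeaks D)
highPeaks-bounded D = filter⁺ (λ (_ , b) → 2 ≤? b) (peaks-bounded z≤n D)

-- On a Dyck path a + b is even, and it is at least 4 at a peak of height at least 2,
-- so neither ∸ nor / truncates there.
topIndex : ℕ × ℕ → ℕ
topIndex (a , b) = (a + b ∸ 2) / 2

runLength : ℕ × ℕ → ℕ
runLength (a , b) = b ∸ 1

letter : ∀ {n} i → .(1 ≤ i) → .(i ≤ n) → Fin n
letter zero    () _
letter (suc i) _  i<n = fromℕ< i<n

double-half : ∀ m → (2 * m) / 2 ≡ m
double-half m = trans (cong (_/ 2) (*-comm 2 m)) (m*n/n≡m m 2)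

topIndex-≤ : ∀ {n} P → Bounded (2 * suc n) P → topIndex P ≤ n
topIndex-≤ {n} (a , b) (_ , a+b≤L) = begin
  (a + b ∸ 2) / 2       ≤⟨ /-monoˡ-≤ 2 (∸-monoˡ-≤ 2 a+b≤L) ⟩
  (2 * suc n ∸ 2) / 2   ≡⟨ cong (λ z → (z ∸ 2) / 2) (*-suc 2 n) ⟩
  (2 * n) / 2           ≡⟨ double-half n ⟩
  n                     ∎
  where open ≤-Reasoning

runLength-≤ : ∀ {L} P → Bounded L P → runLength P ≤ topIndex P
runLength-≤ (a , b) (b≤a , _) = begin
  b ∸ 1                 ≡⟨ double-half (b ∸ 1) ⟨
  (2 * (b ∸ 1)) / 2     ≡⟨ cong (_/ 2) (*-distribˡ-∸ 2 b 1) ⟩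
  (2 * b ∸ 2) / 2       ≡⟨ cong (λ z → (b + z ∸ 2) / 2) (+-identityʳ b) ⟩
  (b + b ∸ 2) / 2       ≤⟨ /-monoˡ-≤ 2 (∸-monoˡ-≤ 2 (+-monoˡ-≤ b b≤a)) ⟩
  (a + b ∸ 2) / 2       ∎
  where open ≤-Reasoning

-- The word x_p x_{p-1} ⋯ x_{p-r+1}, where p = topIndex P and r = runLength P.
run : ∀ {n} P → Bounded (2 * suc n) P → Word n
run P bd = tabulate {n = runLength P} λ k →
  letter (topIndex P ∸ toℕ k)
    (m<n⇒0<n∸m (≤-trans (toℕ<n k) (runLength-≤ P bd)))
    (≤-trans (m∸n≤m (topIndex P) (toℕ k)) (topIndex-≤ P bd))

runs : ∀ n → DyckPath (suc n) → List (Word n)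
runs n D = reduce (λ {P} → run P) (highPeaks-bounded D)

Φ : ∀ n → DyckPath (suc n) → Word n
Φ n D = concat (runs n D)

{-# OPTIONS --safe #-}

-- A Dyck path is read one down step at a time. The peak before the down step number d + 1,
-- if it is high, contributes the run ending in x_{d+1}, so the path is recovered from the
-- pairs (first letter, last letter) of the runs; both components increase strictly
-- along the word. Conversely, prefixing a letter to such a word gives either another such
-- word, or a word that a commutation makes lexicographically smaller, or zero in the algebra.
-- Such a word is lexicographically minimal because a letter that is not the first of its
-- run is blocked by its predecessor, and first letters increase. It is nonzero because it
-- acts nontrivially on configurations of particles on a line, where x_i moves a particle
-- from site i + 1 to the empty site i.
module Submission where

open import Defs
open import Algebra.Bundles using (CommutativeRing; Ring)
import Algebra.Properties.AbelianGroup as AbelianGroupProperties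
import Algebra.Properties.CommutativeSemigroup as CommutativeSemigroupProperties
import Algebra.Properties.Ring as RingProperties
open import Data.Bool.Base using (Bool; true; false)
open import Data.Fin.Base using (Fin; toℕ)
import Data.Fin.Properties as Fin
open import Data.Fin.Properties using (toℕ-injective; toℕ-fromℕ<)
open import Data.List.Base
  using (List; []; _∷_; _++_; _∷ʳ_; applyDownFrom; concat; length; map; replicate; tabulate)
open import Data.List.Properties
  using (++-assoc; ++-cancelˡ; ++-identityʳ; ∷ʳ-++; ∷-injective; ∷-injectiveˡ; concat-++;
         concat-map; length-++; length-replicate; map-injective; map-tabulate; tabulate-cong)
open import Data.List.Relation.Binary.Lex.Strict using (base; this; next)
open import Data.List.Relation.Unary.All as All using (All; []; _∷_; reduce)
import Data.List.Relation.Unary.All.Properties as All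
open import Data.List.Relation.Unary.AllPairs using (_∷_)
open import Data.List.Relation.Unary.Linked as Linked using (Linked; []; [-]; _∷_)
import Data.List.Relation.Unary.Linked.Properties as Linked
open import Data.Maybe.Base as Maybe using (Maybe; just; nothing; maybe′; _>>=_)
open import Data.Nat.Base
  using (ℕ; zero; suc; pred; _+_; _*_; _∸_; ∣_-_∣; _≤_; _<_; _>_; z≤n; s≤s;
         _≤‴_; ≤‴-refl; ≤‴-step)
open import Data.Nat.DivMod using (_/_)
open import Data.Nat.Properties
open import Data.Nat.Tactic.RingSolver using (solve-∀)
open import Data.Product.Base using (Σ-syntax; ∃; ∃₂; _×_; _,_; proj₁; proj₂)
open import Data.Sum.Base using (_⊎_; inj₁; inj₂)
open import Data.Unit.Base using (tt)
open import Function.Base using (_on_)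
open import Function.Bundles using (_⇔_; mk⇔)
open import Function.Definitions using (Bijective)
open import Relation.Binary.Construct.Closure.ReflexiveTransitive using (ε; _◅_; _◅◅_; gmap)
open import Relation.Binary.Definitions using (tri<; tri≈; tri>)
open import Relation.Binary.PropositionalEquality
import Relation.Binary.Reasoning.Setoid as SetoidReasoning
open import Relation.Nullary.Negation.Core using (¬_; contradiction)

-- Particle hops and the defining relations.

Apart : ℕ → ℕ → Set
Apart i j = 1 < ∣ i - j ∣

-- `true` is an occupied site. An impossible hop, including one past the end of the list, gives
-- `nothing`, which stands for the zero vector.
hop : ℕ → List Bool → Maybe (List Bool)
hop zero    (false ∷ true ∷ s) = just (true ∷ false ∷ s)
hop zero    _                  = nothing
hop (suc i) []                 = nothing
hop (suc i) (b ∷ s)            = Maybe.map (b ∷_) (hop i s)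

hops : List ℕ → List Bool → Maybe (List Bool)
hops []      s = just s
hops (i ∷ w) s = hop i s >>= hops w

hop-cons : ∀ i {b} (m : Maybe (List Bool)) →
           (Maybe.map (b ∷_) m >>= hop (suc i)) ≡ Maybe.map (b ∷_) (m >>= hop i)
hop-cons i nothing  = refl
hop-cons i (just s) = refl

hop-square : ∀ i s → (hop i s >>= hop i) ≡ nothing
hop-square zero    []                   = refl
hop-square zero    (true ∷ s)           = refl
hop-square zero    (false ∷ [])         = refl
hop-square zero    (false ∷ false ∷ s)  = refl
hop-square zero    (false ∷ true ∷ s)   = refl
hop-square (suc i) []                   = refl
hop-square (suc i) (b ∷ s)
  rewrite hop-cons i {b} (hop i s) | hop-square i s = refl

hop-commute₀ : ∀ j s → (hop 0 s >>= hop (2 + j)) ≡ (hop (2 + j) s >>= hop 0)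
hop-commute₀ j []            = refl
hop-commute₀ j (true ∷ [])   = refl
hop-commute₀ j (false ∷ [])  = refl
hop-commute₀ j (a ∷ b ∷ s) with hop j s in eq
hop-commute₀ j (true ∷ b ∷ s)      | nothing = refl
hop-commute₀ j (false ∷ false ∷ s) | nothing = refl
hop-commute₀ j (false ∷ true ∷ s)  | nothing rewrite eq = refl
hop-commute₀ j (true ∷ b ∷ s)      | just _  = refl
hop-commute₀ j (false ∷ false ∷ s) | just _  = refl
hop-commute₀ j (false ∷ true ∷ s)  | just _  rewrite eq = refl

hop-commute : ∀ i j → Apart i j → ∀ s → (hop i s >>= hop j) ≡ (hop j s >>= hop i)
hop-commute zero          zero          ()
hop-commute zero          (suc zero)    (s≤s ())
hop-commute zero          (suc (suc j)) _        s       = hop-commute₀ j s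
hop-commute (suc zero)    zero          (s≤s ())
hop-commute (suc (suc i)) zero          _        s       = sym (hop-commute₀ i s)
hop-commute (suc i)       (suc j)       apart    []      = refl
hop-commute (suc i)       (suc j)       apart    (b ∷ s)
  rewrite hop-cons j {b} (hop i s) | hop-cons i {b} (hop j s) =
  cong (Maybe.map (b ∷_)) (hop-commute i j apart s)

-- The first hop fills site `i`; the hop at `suc i` leaves it filled, so the last hop is blocked.
hop-braid : ∀ i s → (hop i s >>= hop (suc i) >>= hop i) ≡ nothing
hop-braid zero    []                            = refl
hop-braid zero    (true ∷ s)                    = refl
hop-braid zero    (false ∷ [])                  = refl
hop-braid zero    (false ∷ false ∷ s)           = refl
hop-braid zero    (false ∷ true ∷ [])           = refl
hop-braid zero    (false ∷ true ∷ true ∷ s)     = refl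
hop-braid zero    (false ∷ true ∷ false ∷ s)    = refl
hop-braid (suc i) []                            = refl
hop-braid (suc i) (b ∷ s)
  rewrite hop-cons (suc i) {b} (hop i s) | hop-cons i {b} (hop i s >>= hop (suc i))
        | hop-braid i s = refl

-- The first hop empties site `i + 2` and the hop at `i` does not refill it, so the last hop finds
-- no particle there.
hop-braid′ : ∀ i s → (hop (suc i) s >>= hop i >>= hop (suc i)) ≡ nothing
hop-braid′ zero    []                           = refl
hop-braid′ zero    (b ∷ [])                     = refl
hop-braid′ zero    (b ∷ true ∷ s)               = refl
hop-braid′ zero    (b ∷ false ∷ [])             = refl
hop-braid′ zero    (b ∷ false ∷ false ∷ s)      = refl
hop-braid′ zero    (true ∷ false ∷ true ∷ s)    = refl
hop-braid′ zero    (false ∷ false ∷ true ∷ s)   = refl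
hop-braid′ (suc i) []                           = refl
hop-braid′ (suc i) (b ∷ s)
  rewrite hop-cons i {b} (hop (suc i) s) | hop-cons (suc i) {b} (hop (suc i) s >>= hop i)
        | hop-braid′ i s = refl

-- The linear action on functions of configurations.

module Particles {c ℓ} (K : CommutativeRing c ℓ) (n : ℕ) where

  open NilTemperleyLieb K n
  private module K = CommutativeRing K
  open K using (Carrier; 0#; 1#) renaming (_≈_ to _≃_; _+_ to _+ᴷ_; _*_ to _*ᴷ_; -_ to -ᴷ_)
  open RingProperties K.ring using (-‿distribʳ-*)
  open AbelianGroupProperties K.+-abelianGroup using (⁻¹-∙-comm)
  open CommutativeSemigroupProperties K.+-commutativeSemigroup using (interchange)
  open CommutativeSemigroupProperties K.*-commutativeSemigroup using (x∙yz≈y∙xz)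

  -- A generator pulls functions back along its hop. Pullback makes the leftmost letter of a word
  -- hop first, in agreement with `hops`.
  act : Expr → (List Bool → Carrier) → List Bool → Carrier
  act (x i)     g s = maybe′ g 0# (hop (toℕ i) s)
  act (const k) g s = k *ᴷ g s
  act (e ⊕ f)   g s = act e g s +ᴷ act f g s
  act (e ⊗ f)   g s = act e (act f g) s
  act (⊖ e)     g s = -ᴷ act e g s

  act-cong : ∀ e {g h} → (∀ s → g s ≃ h s) → ∀ s → act e g s ≃ act e h s
  act-cong (x i)     g≃h s with hop (toℕ i) s
  ... | nothing = K.refl
  ... | just s′ = g≃h s′
  act-cong (const k) g≃h s = K.*-congˡ (g≃h s)
  act-cong (e ⊕ f)   g≃h s = K.+-cong (act-cong e g≃h s) (act-cong f g≃h s)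
  act-cong (e ⊗ f)   g≃h s = act-cong e (act-cong f g≃h) s
  act-cong (⊖ e)     g≃h s = K.-‿cong (act-cong e g≃h s)

  act-+ : ∀ e g h s → act e (λ t → g t +ᴷ h t) s ≃ act e g s +ᴷ act e h s
  act-+ (x i)     g h s with hop (toℕ i) s
  ... | nothing = K.sym (K.+-identityˡ 0#)
  ... | just _  = K.refl
  act-+ (const k) g h s = K.distribˡ k (g s) (h s)
  act-+ (e ⊕ f)   g h s = K.trans (K.+-cong (act-+ e g h s) (act-+ f g h s)) (interchange _ _ _ _)
  act-+ (e ⊗ f)   g h s = K.trans (act-cong e (act-+ f g h) s) (act-+ e _ _ s)
  act-+ (⊖ e)     g h s = K.trans (K.-‿cong (act-+ e g h s)) (K.sym (⁻¹-∙-comm _ _))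

  -- Linearity in the function is what soundness of `const-central` asks for; `act-+` serves
  -- `⊗-distribˡ` in the same way.
  act-* : ∀ e k g s → act e (λ t → k *ᴷ g t) s ≃ k *ᴷ act e g s
  act-* (x i)     k g s with hop (toℕ i) s
  ... | nothing = K.sym (K.zeroʳ k)
  ... | just _  = K.refl
  act-* (const l) k g s = x∙yz≈y∙xz l k (g s)
  act-* (e ⊕ f)   k g s =
    K.trans (K.+-cong (act-* e k g s) (act-* f k g s)) (K.sym (K.distribˡ k _ _))
  act-* (e ⊗ f)   k g s = K.trans (act-cong e (act-* f k g) s) (act-* e k _ s)
  act-* (⊖ e)     k g s = K.trans (K.-‿cong (act-* e k g s)) (-‿distribʳ-* k _)

  maybe-bind : (g : List Bool → Carrier) (h : List Bool → Maybe (List Bool)) (m : Maybe (List Bool)) →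
              maybe′ (λ t → maybe′ g 0# (h t)) 0# m ≡ maybe′ g 0# (m >>= h)
  maybe-bind g h nothing  = refl
  maybe-bind g h (just _) = refl

  act-xx : ∀ i j g s → act (x i ⊗ x j) g s ≡ maybe′ g 0# (hop (toℕ i) s >>= hop (toℕ j))
  act-xx i j g s = maybe-bind g _ (hop (toℕ i) s)

  act-xxx : ∀ i j k g s → act (x i ⊗ x j ⊗ x k) g s ≡
            maybe′ g 0# (hop (toℕ i) s >>= hop (toℕ j) >>= hop (toℕ k))
  act-xxx i j k g s =
    trans (act-xx i j _ s) (maybe-bind g _ (hop (toℕ i) s >>= hop (toℕ j)))

  act-nothing : ∀ {m} g s → m ≡ nothing → maybe′ g 0# m ≃ act 𝟘 g s
  act-nothing g s refl = K.sym (K.zeroˡ (g s))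

  act-sound : ∀ {e f} → e ≈ f → ∀ g s → act e g s ≃ act f g s
  act-sound ≈-refl                g s = K.refl
  act-sound (≈-sym p)             g s = K.sym (act-sound p g s)
  act-sound (≈-trans p q)         g s = K.trans (act-sound p g s) (act-sound q g s)
  act-sound (⊕-cong p q)          g s = K.+-cong (act-sound p g s) (act-sound q g s)
  act-sound (⊗-cong {e} p q)      g s = K.trans (act-cong e (act-sound q g) s) (act-sound p _ s)
  act-sound (⊖-cong p)            g s = K.-‿cong (act-sound p g s)
  act-sound (⊕-assoc e f h)       g s = K.+-assoc _ _ _
  act-sound (⊕-comm e f)          g s = K.+-comm _ _
  act-sound (⊕-identityˡ e)       g s = K.trans (K.+-congʳ (K.zeroˡ _)) (K.+-identityˡ _)
  act-sound (⊕-inverseˡ e)        g s = K.trans (K.-‿inverseˡ _) (K.sym (K.zeroˡ _))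
  act-sound (⊗-assoc e f h)       g s = K.refl
  act-sound (⊗-identityˡ e)       g s = K.*-identityˡ _
  act-sound (⊗-identityʳ e)       g s = act-cong e (λ t → K.*-identityˡ (g t)) s
  act-sound (⊗-distribˡ e f h)    g s = act-+ e _ _ s
  act-sound (⊗-distribʳ e f h)    g s = K.refl
  act-sound (const-cong p)        g s = K.*-congʳ p
  act-sound (const-+ k l)         g s = K.distribʳ _ _ _
  act-sound (const-* k l)         g s = K.*-assoc _ _ _
  act-sound (const-central k e)   g s = K.sym (act-* e k g s)
  act-sound (x-square i)          g s =
    K.trans (K.reflexive (act-xx i i g s)) (act-nothing g s (hop-square (toℕ i) s))
  act-sound (x-commute {i} {j} p) g s = K.reflexive (trans (act-xx i j g s)
    (trans (cong (maybe′ g 0#) (hop-commute (toℕ i) (toℕ j) p s)) (sym (act-xx j i g s))))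
  act-sound (x-braid {i} {j} p)   g s rewrite act-xxx i j i g s | p =
    act-nothing g s (hop-braid (toℕ i) s)
  act-sound (x-braid′ {i} {j} p)  g s rewrite act-xxx j i j g s | p =
    act-nothing g s (hop-braid′ (toℕ i) s)

  act-word : ∀ w g s → act ⟦ w ⟧ g s ≃ maybe′ g 0# (hops (map toℕ w) s)
  act-word []      g s = K.*-identityˡ (g s)
  act-word (i ∷ w) g s with hop (toℕ i) s
  ... | nothing = K.refl
  ... | just s′ = act-word w g s′

  -- Evaluate the action on the constant function 1 at `s`: the word gives 1 there, whereas an
  -- expression equal to zero gives 0.
  hops⇒irreducible : ¬ (1# ≃ 0#) → ∀ w {s s′} → hops (map toℕ w) s ≡ just s′ → ¬ Reducible w
  hops⇒irreducible 1≄0 w {s} eq w≈𝟘 = 1≄0 (K.trans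
    (K.reflexive (cong (maybe′ _ 0#) (sym eq)))
    (K.trans (K.sym (act-word w _ s)) (K.trans (act-sound w≈𝟘 (λ _ → 1#) s) (K.zeroˡ 1#))))

-- Codes of runs and the particles they move.

-- (q , m) codes the run of the letters q + m , … , q + 1 , q, counted from 0 as by toℕ.
Code : Set
Code = ℕ × ℕ

descent : ℕ → ℕ → List ℕ
descent q k = applyDownFrom (q +_) k

letters : Code → List ℕ
letters (q , m) = descent q (suc m)

spell : List Code → List ℕ
spell c = concat (map letters c)

-- d and b are the number of down steps before, and the height of, the point from which a
-- path is read; after a run (q , m) they become suc q and suc m, so the first and the last
-- letters of the runs both increase strictly.
data Chain (d b : ℕ) : List Code → Set where
  []   : Chain d b []
  link : ∀ {q m c} → d ≤ q → d + b ≤ suc (q + m) → Chain (suc q) (suc m) c →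
         Chain d b ((q , m) ∷ c)

chain-weaken : ∀ {d b d′ b′ c} → d ≤ d′ → d + b ≤ d′ + b′ → Chain d′ b′ c → Chain d b c
chain-weaken p q []             = []
chain-weaken p q (link r s ch) = link (≤-trans p r) (≤-trans q s) ch

replicate-++-∷ : ∀ {A : Set} k (a : A) s → replicate k a ++ a ∷ s ≡ a ∷ replicate k a ++ s
replicate-++-∷ zero    a s = refl
replicate-++-∷ (suc k) a s = cong (a ∷_) (replicate-++-∷ k a s)

replicate-+-++ : ∀ {A : Set} k l (a : A) s →
                 replicate (k + l) a ++ s ≡ replicate k a ++ replicate l a ++ s
replicate-+-++ zero    l a s = refl
replicate-+-++ (suc k) l a s = cong (a ∷_) (replicate-+-++ k l a s)

hop-at : ∀ i pre s → length pre ≡ i →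
         hop i (pre ++ false ∷ true ∷ s) ≡ just (pre ++ true ∷ false ∷ s)
hop-at zero    []        s refl = refl
hop-at (suc i) (b ∷ pre) s eq   rewrite hop-at i pre s (suc-injective eq) = refl

hops-++ : ∀ u v s → hops (u ++ v) s ≡ (hops u s >>= hops v)
hops-++ []      v s = refl
hops-++ (i ∷ u) v s with hop i s
... | nothing = refl
... | just s′ = hops-++ u v s′

hops-descent : ∀ q k pre s → length pre ≡ q →
               hops (descent q k) (pre ++ replicate k false ++ true ∷ s) ≡
               just (pre ++ true ∷ replicate k false ++ s)
hops-descent q zero    pre s eq = refl
hops-descent q (suc k) pre s eq
  rewrite sym (replicate-++-∷ k false (true ∷ s))
        | sym (++-assoc pre (replicate k false) (false ∷ true ∷ s))
        | hop-at (q + k) (pre ++ replicate k false) s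
            (trans (length-++ pre) (cong₂ _+_ eq (length-replicate k)))
        | ++-assoc pre (replicate k false) (true ∷ false ∷ s)
        | hops-descent q k pre (false ∷ s) eq
        | replicate-++-∷ k false s = refl

-- Put a particle one site above the first letter of each run; each run then moves its
-- own particle down to the site of its last letter, and leaves empty sites behind it.
chain-hops : ∀ {d b c} → Chain d b c → ∃ λ s → ∀ pre → length pre ≡ d →
             ∃ λ s′ → hops (spell c) (pre ++ replicate b false ++ s) ≡ just s′
chain-hops [] = [] , λ pre _ → _ , refl
chain-hops {d} {b} (link {q} {m} {c} d≤q d+b≤ ch)
  with chain-hops ch | m≤n⇒∃[o]m+o≡n d≤q | m≤n⇒∃[o]m+o≡n d+b≤
... | s , IH | j , d+j≡q | y , d+b+y≡ = replicate y false ++ true ∷ s , moved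
  where
  gap : b + y ≡ j + suc m
  gap = +-cancelˡ-≡ d _ _ (begin
    d + (b + y)     ≡⟨ +-assoc d b y ⟨
    d + b + y       ≡⟨ d+b+y≡ ⟩
    suc (q + m)     ≡⟨ +-suc q m ⟨
    q + suc m       ≡⟨ cong (_+ suc m) d+j≡q ⟨
    d + j + suc m   ≡⟨ +-assoc d j (suc m) ⟩
    d + (j + suc m) ∎)
    where open ≡-Reasoning
  length-pre′ : ∀ pre → length pre ≡ d → length (pre ++ replicate j false) ≡ q
  length-pre′ pre eq = trans (length-++ pre) (trans (cong₂ _+_ eq (length-replicate j)) d+j≡q)
  moved : ∀ pre → length pre ≡ d → ∃ λ s′ →
          hops (spell ((q , m) ∷ c)) (pre ++ replicate b false ++ replicate y false ++ true ∷ s)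
          ≡ just s′
  moved pre eq
    rewrite sym (replicate-+-++ b y false (true ∷ s)) | gap
          | replicate-+-++ j (suc m) false (true ∷ s)
          | sym (++-assoc pre (replicate j false) (replicate (suc m) false ++ true ∷ s))
          | hops-++ (letters (q , m)) (spell c)
              ((pre ++ replicate j false) ++ replicate (suc m) false ++ true ∷ s)
          | hops-descent q (suc m) (pre ++ replicate j false) s (length-pre′ pre eq)
          | sym (∷ʳ-++ (pre ++ replicate j false) true (replicate (suc m) false ++ s))
    -- The moved particle closes a prefix of length `suc q`; behind it lie the `suc m` empty sites
    -- that the rest of the chain expects.
    = IH ((pre ++ replicate j false) ∷ʳ true)
         (trans (length-++ (pre ++ replicate j false))
           (trans (+-comm _ 1) (cong suc (length-pre′ pre eq))))

-- Commutation classes and lexicographic minimality.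

-- Extract a w r: commutations bring an occurrence of a to the front of w and leave r.
data Extract {n} (a : Fin n) : Word n → Word n → Set where
  here  : ∀ {w} → Extract a (a ∷ w) w
  there : ∀ {b w r} → Far a b → Extract a w r → Extract a (b ∷ w) (b ∷ r)

far-sym : ∀ {n} (i j : Fin n) → Far i j → Far j i
far-sym i j = subst (1 <_) (∣-∣-comm (toℕ i) (toℕ j))

swap-∷ : ∀ {n} (a : Fin n) {w v} → Swap w v → Swap (a ∷ w) (a ∷ v)
swap-∷ a (swap u v far) = swap (a ∷ u) v far

equivalent-∷ : ∀ {n} (a : Fin n) {w v} → Equivalent w v → Equivalent (a ∷ w) (a ∷ v)
equivalent-∷ a = gmap (a ∷_) (swap-∷ a)

-- If the extracted letter belongs to the swapped pair, the swap becomes one commutation more or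
-- less in the extraction; otherwise it survives as a swap of the remainders.
extract-swap : ∀ {n} {a : Fin n} {w v r} → Swap w v → Extract a v r →
               ∃ λ r′ → Extract a w r′ × Equivalent r′ r
extract-swap (swap [] {i} {j} v far) here               = _ , there (far-sym i j far) here , ε
extract-swap (swap [] v far) (there _ here)             = _ , here , ε
extract-swap (swap [] v far) (there p (there q ex))     =
  _ , there q (there p ex) , swap [] _ far ◅ ε
extract-swap (swap (b ∷ u) v far) here                  = _ , here , swap u v far ◅ ε
extract-swap (swap (b ∷ u) v far) (there p ex) with extract-swap (swap u v far) ex
... | r′ , ex′ , r′~r = _ , there p ex′ , equivalent-∷ b r′~r

extract-equivalent : ∀ {n} {a : Fin n} {w v r} → Equivalent w v → Extract a v r →
                     ∃ λ r′ → Extract a w r′ × Equivalent r′ r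
extract-equivalent ε        ex = _ , ex , ε
extract-equivalent (s ◅ w~v) ex with extract-equivalent w~v ex
... | r₁ , ex₁ , r₁~r with extract-swap s ex₁
... | r₂ , ex₂ , r₂~r₁ = r₂ , ex₂ , r₂~r₁ ◅◅ r₁~r

data Front (a : ℕ) : List ℕ → Set where
  here  : ∀ {w} → Front a (a ∷ w)
  there : ∀ {b w} → Apart a b → Front a w → Front a (b ∷ w)

extract⇒front : ∀ {n} {a : Fin n} {w r} → Extract a w r → Front (toℕ a) (map toℕ w)
extract⇒front here         = here
extract⇒front (there p ex) = there p (extract⇒front ex)

swap-≢[] : ∀ {n} {w v : Word n} → Swap w v → v ≢ []
swap-≢[] (swap []      _ _) ()
swap-≢[] (swap (_ ∷ _) _ _) ()

equivalent-≢[] : ∀ {n} {w v : Word n} → w ≢ [] → Equivalent w v → v ≢ []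
equivalent-≢[] w≢[] ε         = w≢[]
equivalent-≢[] _    (s ◅ w~v) = equivalent-≢[] (swap-≢[] s) w~v

-- This is the local criterion of Anisimov and Knuth for lexicographic normal forms under partial
-- commutation.
data Normal : List ℕ → Set where
  []  : Normal []
  _∷_ : ∀ {b w} → (∀ {a} → Apart a b → Front a w → b < a) → Normal w → Normal (b ∷ w)

-- The first letter of `v` can be extracted from `w`. Either it is the head of `w`, and the tails
-- are compared, or it has passed the head and is larger by `Normal`.
normal⇒minimal : ∀ {n} {w v : Word n} → Normal (map toℕ w) → Equivalent w v → w ≤lex v
normal⇒minimal {w = []}    {[]}    _ _ = base tt
normal⇒minimal {w = _ ∷ _} {[]}    _ w~[] = contradiction refl (equivalent-≢[] (λ ()) w~[])
normal⇒minimal {w = w}     {a ∷ v} nf w~v with extract-equivalent w~v here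
normal⇒minimal {w = []}    {_ ∷ _} _ _ | _ , () , _
normal⇒minimal {w = _ ∷ _} (_ ∷ nf) _ | _ , here , w~v = next refl (normal⇒minimal nf w~v)
normal⇒minimal {w = _ ∷ _} (b<a ∷ nf) _ | _ , there far ex , _ = this (b<a far (extract⇒front ex))

apart-suc : ∀ a → ¬ Apart a (suc a)
apart-suc a p with subst (λ b → 1 < ∣ a - b ∣) (+-comm 1 a) p
... | q with subst (1 <_) (∣m-m+n∣≡n a 1) q
... | s≤s ()

front-descent : ∀ {a} q m {w} → Front a (descent q (suc m) ++ w) → a ≡ q + m ⊎ Front a w
front-descent q m       here                 = inj₁ refl
front-descent q zero    (there _ fr)         = inj₂ fr
front-descent q (suc m) (there apart fr) with front-descent q m fr
... | inj₁ refl = contradiction (subst (Apart (q + m)) (+-suc q m) apart) (apart-suc (q + m))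
... | inj₂ fr′  = inj₂ fr′

chain-front : ∀ {d b c a} → Chain d b c → Front a (spell c) → d + b ≤ suc a
chain-front {d} {b} {a = a} (link {q} {m} d≤q d+b≤ ch) fr with front-descent q m fr
... | inj₁ refl = d+b≤
... | inj₂ fr′  = begin
  d + b         ≤⟨ d+b≤ ⟩
  suc (q + m)   ≡⟨ +-suc q m ⟨
  q + suc m     ≤⟨ n≤1+n _ ⟩
  suc q + suc m ≤⟨ chain-front ch fr′ ⟩
  suc a         ∎
  where open ≤-Reasoning

descent-normal : ∀ q k {w} → (∀ {a} → Front a w → q + k ≤ a) → Normal w → Normal (descent q k ++ w)
descent-normal q zero    above nf = nf
descent-normal q (suc k) {w} above nf =
  step ∷ descent-normal q k (λ fr → ≤-trans (+-monoʳ-≤ q (n≤1+n k)) (above fr)) nf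
  where
  -- The first letter of the remaining run is adjacent to `q + k`, so a letter apart from `q + k`
  -- comes from beyond the run.
  step′ : ∀ {a} k → Apart a (q + k) → Front a (descent q k ++ w) → Front a w
  step′ zero    apart fr = fr
  step′ (suc k) apart fr with front-descent q k fr
  ... | inj₁ refl = contradiction (subst (Apart (q + k)) (+-suc q k) apart) (apart-suc (q + k))
  ... | inj₂ fr′  = fr′
  step : ∀ {a} → Apart a (q + k) → Front a (descent q k ++ w) → q + k < a
  step {a} apart fr = subst (_≤ a) (+-suc q k) (above (step′ {a} k apart fr))

chain-normal : ∀ {d b c} → Chain d b c → Normal (spell c)
chain-normal []                     = []
chain-normal (link {q} {m} _ _ ch) =
  descent-normal q (suc m) (λ fr → ≤-pred (chain-front ch fr)) (chain-normal ch)

-- From Dyck paths to chains, and injectivity.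

-- The second argument is the height after the peak, so 0 means a low peak. A peak of height `m + 2`
-- after `d` down steps has first index `d + m + 1` and last index `d + 1`; counted from 0 these are
-- `d + m` and `d`.
peakCode : ℕ → ℕ → List Code
peakCode d zero    = []
peakCode d (suc m) = (d , m) ∷ []

-- d is the number of down steps before the path.
codes : ∀ {L a b} → ℕ → Path L a b → List Code
codes d end                     = []
codes d (up (down {b = b} p))   = peakCode d b ++ codes (suc d) p
codes d (up (up p))             = codes d (up p)
codes d (down p)                = codes (suc d) p

codes-chain : ∀ {L a b} d (p : Path L a b) → Chain d b (codes d p)
codes-chain d end                           = []
codes-chain d (up (down {b = zero} p))      =
  chain-weaken (n≤1+n d) (n≤1+n _) (codes-chain (suc d) p)
codes-chain d (up (down {b = suc m} p))     =
  link ≤-refl (≤-reflexive (+-suc d m)) (codes-chain (suc d) p)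
codes-chain d (up (up p))                   =
  chain-weaken ≤-refl (+-monoʳ-≤ d (n≤1+n _)) (codes-chain d (up p))
codes-chain d (down p)                      =
  chain-weaken (n≤1+n d) (≤-reflexive (+-suc d _)) (codes-chain (suc d) p)

descent-≥ : ∀ q k → All (q ≤_) (descent q k)
descent-≥ q zero    = []
descent-≥ q (suc k) = m≤m+n q k ∷ descent-≥ q k

chain-≥ : ∀ {d b c} → Chain d b c → All (d ≤_) (spell c)
chain-≥ []                              = []
chain-≥ (link {q} {m} d≤q _ ch) =
  All.++⁺ (All.map (≤-trans d≤q) (descent-≥ q (suc m)))
          (All.map (λ q<a → ≤-trans d≤q (<⇒≤ q<a)) (chain-≥ ch))

descent-last : ∀ {P : ℕ → Set} q m {w} → All P (descent q (suc m) ++ w) → P q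
descent-last {P} q zero    (px ∷ _)  = subst P (+-identityʳ q) px
descent-last     q (suc m) (_ ∷ pxs) = descent-last q m pxs

-- No down step precedes the next peak, so its run ends in `d`; the peak has height at least
-- `b + 2`, hence `b ≤ m`.
codes-up : ∀ {L a b} d (p : Path L (suc a) (suc (suc b))) →
           ∃₂ λ m c → b ≤ m × codes d (up p) ≡ (d , m) ∷ c
codes-up d (down p) = _ , _ , ≤-refl , refl
codes-up d (up p) with codes-up d p
... | m , c , b<m , eq = m , c , <⇒≤ b<m , eq

-- On the right the first run ends in the letter `d`; on the left every letter is at least `suc d`.
down≢up : ∀ {L a a′ b b′} d (p : Path L a b) (p′ : Path L (suc a′) (suc (suc b′))) →
          spell (codes (suc d) p) ≢ spell (codes d (up p′))
down≢up d p p′ eq with codes-up d p′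
... | m , c , _ , eq′ =
  <-irrefl refl (descent-last d m
    (subst (All (d <_)) (trans eq (cong spell eq′)) (chain-≥ (codes-chain (suc d) p))))

-- A low peak behaves like a down step. At a high one both first runs end in `d`, but the path that
-- keeps climbing reaches a higher peak and so a larger first letter.
peak≢up : ∀ {L a b} d (p : Path L (suc (suc a)) b) (p′ : Path L (suc (suc a)) (suc (suc b))) →
          spell (codes d (up (down p))) ≢ spell (codes d (up p′))
peak≢up {b = zero}  d p p′ eq = down≢up d p p′ eq
peak≢up {b = suc b} d p p′ eq with codes-up d p′
... | m , c , b<m , eq′ =
  <-irrefl (+-cancelˡ-≡ d _ _ (∷-injectiveˡ (trans eq (cong spell eq′)))) b<m

mutual
  -- The paths are compared step by step; where they first differ, so do the words. After an up step
  -- the second function takes over, since `codes` inspects the step that follows.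
  spell-codes-injective : ∀ {L a b} d (p p′ : Path L a b) →
                          spell (codes d p) ≡ spell (codes d p′) → p ≡ p′
  spell-codes-injective d end       end       eq = refl
  spell-codes-injective d end       (up p′)   eq =
    contradiction (≤-trans (m≤m+n _ 1) (path-bound p′)) (<-irrefl refl)
  spell-codes-injective d (up p)    end       eq =
    contradiction (≤-trans (m≤m+n _ 1) (path-bound p)) (<-irrefl refl)
  spell-codes-injective d (up p)    (up p′)   eq = cong up (spell-codes-up-injective d p p′ eq)
  spell-codes-injective d (down p)  (down p′) eq = cong down (spell-codes-injective (suc d) p p′ eq)
  spell-codes-injective d (down p)  (up p′)   eq = contradiction eq (down≢up d p p′)
  spell-codes-injective d (up p)    (down p′) eq = contradiction (sym eq) (down≢up d p′ p)

  spell-codes-up-injective : ∀ {L a b} d (p p′ : Path L (suc a) (suc b)) →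
                             spell (codes d (up p)) ≡ spell (codes d (up p′)) → p ≡ p′
  spell-codes-up-injective d (up p) (up p′) eq = cong up (spell-codes-up-injective d p p′ eq)
  spell-codes-up-injective d (down {b = zero} p) (down p′) eq =
    cong down (spell-codes-injective (suc d) p p′ eq)
  spell-codes-up-injective d (down {b = suc m} p) (down p′) eq =
    cong down (spell-codes-injective (suc d) p p′ (++-cancelˡ (letters (d , m)) _ _ eq))
  spell-codes-up-injective d (down p) (up p′) eq = contradiction eq (peak≢up d p p′)
  spell-codes-up-injective d (up p) (down p′) eq = contradiction (sym eq) (peak≢up d p′ p)

-- Rebuilding a path from a chain.

-- The up steps to a peak of height `m + 2` and its down step are put in front of `p`. With `≤‴` the
-- induction raises `b` by one per up step.
climb : ∀ {L a a′ b m} d → b ≤‴ suc m → a′ + b ≡ suc (suc a) + suc m →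
        (p : Path L a′ (suc m)) →
        Σ[ p′ ∈ Path L (suc a) (suc b) ] codes d (up p′) ≡ (d , m) ∷ codes (suc d) p
climb {a = a} {a′} {m = m} d ≤‴-refl eq p with +-cancelʳ-≡ (suc m) a′ (suc (suc a)) eq
... | refl = down p , refl
climb {a = a} {a′} {b} d (≤‴-step b<) eq p
  with climb {a = suc a} d b< (trans (+-suc a′ b) (cong suc eq)) p
... | p′ , eq′ = up p′ , eq′

down-abscissa : ∀ b d → suc (suc b + 2 * d) ≡ b + 2 * suc d
down-abscissa = solve-∀

climb-length : ∀ b d m → suc m + 2 * suc d + b ≡ suc (suc (b + 2 * d)) + suc m
climb-length = solve-∀

TopBelow : ℕ → Code → Set
TopBelow N (q , m) = suc (q + m) < N

-- k is the number of down steps still to come; the next of them ends a peak of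
-- height at least 2 exactly when the first run ends at d.
mutual
  decode : ∀ {N a} k d b {c} → d + k ≡ N → a ≡ b + 2 * d → b ≤ k →
           Chain d b c → All (TopBelow N) c → Σ[ p ∈ Path (2 * N) a b ] codes d p ≡ c
  decode zero d zero eN refl b≤k [] below with trans (sym (+-identityʳ d)) eN
  ... | refl = end , refl
  decode zero d b refl ea b≤k (link {q} {m} d≤q _ _) (top< ∷ _) =
    contradiction (<-≤-trans top< (≤-trans (≤-reflexive (+-identityʳ d)) d≤q))
                  (≤⇒≯ (≤-trans (m≤m+n q m) (n≤1+n _)))
  decode (suc k) d b eN ea b≤k [] [] = decode-low k d b eN ea b≤k [] []
  decode (suc k) d b eN ea b≤k (link {q} {m} d≤q d+b≤ ch) (top< ∷ below) with m≤n⇒m<n∨m≡n d≤q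
  ... | inj₁ d<q =
    decode-low k d b eN ea b≤k (link d<q (lower b d+b≤) ch) (top< ∷ below)
    where
    lower : ∀ b → d + b ≤ suc (q + m) → suc d + pred b ≤ suc (q + m)
    lower zero    _ = s≤s (≤-trans (≤-reflexive (+-identityʳ d)) (≤-trans d≤q (m≤m+n q m)))
    lower (suc b) h = ≤-trans (≤-reflexive (sym (+-suc d b))) h
  decode (suc k) d b {(_ , m) ∷ _} refl refl b≤k (link d≤q d+b≤ ch) (top< ∷ below) | inj₂ refl
    -- After the down step of this peak the height is `suc m`; `top<` ensures that `k` down steps
    -- are enough to descend from there.
    with decode {a = suc m + 2 * suc d} k (suc d) (suc m) (sym (+-suc d k)) refl
           (≤-pred (+-cancelˡ-< d _ _ (≤-trans (≤-reflexive (cong suc (+-suc d m))) top<))) ch below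
  ... | p , refl
    with climb d (≤⇒≤‴ (+-cancelˡ-≤ d _ _ (≤-trans d+b≤ (≤-reflexive (sym (+-suc d m))))))
               (climb-length b d m) p
  ... | p′ , eq = up p′ , eq

  -- At height 0 an up step must come first and makes a peak of height 1; at positive height it
  -- would make a high peak, so the down step comes at once. Either way the height becomes `pred b`.
  decode-low : ∀ {N a} k d b {c} → d + suc k ≡ N → a ≡ b + 2 * d → b ≤ suc k →
               Chain (suc d) (pred b) c → All (TopBelow N) c →
               Σ[ p ∈ Path (2 * N) a b ] codes d p ≡ c
  decode-low k d zero    refl refl _         ch below
    with decode k (suc d) 0 (sym (+-suc d k)) (sym (*-suc 2 d)) z≤n ch below
  ... | p , eq = up (down p) , eq
  decode-low k d (suc b) refl refl (s≤s b≤k) ch below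
    with decode k (suc d) b (sym (+-suc d k)) (down-abscissa b d) b≤k ch below
  ... | p , eq = down p , eq

-- Irreducible minimal words are chains.

apart-above : ∀ {i j} → suc i < j → Apart j i
apart-above {zero}  {suc j} p       = p
apart-above {suc i} {suc j} (s≤s p) = apart-above p

apart-below : ∀ {i j} → suc i < j → Apart i j
apart-below {zero}  {suc j} p       = p
apart-below {suc i} {suc j} (s≤s p) = apart-below p

module Monomials {c ℓ} (K : CommutativeRing c ℓ) (n : ℕ) where

  open NilTemperleyLieb K n
  private module A = Ring algebra
  open SetoidReasoning A.setoid

  zero-prefix : ∀ {e f} → e ≈ 𝟘 → e ⊗ f ≈ 𝟘
  zero-prefix e≈𝟘 = ≈-trans (⊗-cong e≈𝟘 ≈-refl) (A.zeroˡ _)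

  reducible-∷ : ∀ i {w} → Reducible w → Reducible (i ∷ w)
  reducible-∷ i w≈𝟘 = ≈-trans (⊗-cong ≈-refl w≈𝟘) (A.zeroʳ _)

  minimal-tail : ∀ (i : Fin n) {w : Word n} → (∀ v → Equivalent (i ∷ w) v → (i ∷ w) ≤lex v) →
                 ∀ v → Equivalent w v → w ≤lex v
  minimal-tail i min v w~v with min (i ∷ v) (equivalent-∷ i w~v)
  ... | this i<i      = contradiction i<i (<-irrefl refl)
  ... | next _ w≤v    = w≤v

  square-reducible : ∀ i w → Reducible (i ∷ i ∷ w)
  square-reducible i w = begin
    x i ⊗ (x i ⊗ ⟦ w ⟧) ≈⟨ ⊗-assoc _ _ _ ⟨
    x i ⊗ x i ⊗ ⟦ w ⟧   ≈⟨ zero-prefix (x-square i) ⟩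
    𝟘                   ∎

  triple-reducible : ∀ i j k {e} → x i ⊗ x j ⊗ x k ≈ 𝟘 → x i ⊗ (x j ⊗ (x k ⊗ e)) ≈ 𝟘
  triple-reducible i j k {e} ijk≈𝟘 = begin
    x i ⊗ (x j ⊗ (x k ⊗ e)) ≈⟨ ⊗-assoc _ _ _ ⟨
    x i ⊗ x j ⊗ (x k ⊗ e)   ≈⟨ ⊗-assoc _ _ _ ⟨
    x i ⊗ x j ⊗ x k ⊗ e     ≈⟨ zero-prefix ijk≈𝟘 ⟩
    𝟘                       ∎

  commute-front : ∀ {i j} e → Far i j → x i ⊗ (x j ⊗ e) ≈ x j ⊗ (x i ⊗ e)
  commute-front {i} {j} e far = begin
    x i ⊗ (x j ⊗ e) ≈⟨ ⊗-assoc _ _ _ ⟨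
    x i ⊗ x j ⊗ e   ≈⟨ ⊗-cong (x-commute far) ≈-refl ⟩
    x j ⊗ x i ⊗ e   ≈⟨ ⊗-assoc _ _ _ ⟩
    x j ⊗ (x i ⊗ e) ∎

  extract-sound : ∀ {a w r} → Extract a w r → ⟦ w ⟧ ≈ x a ⊗ ⟦ r ⟧
  extract-sound here                     = ≈-refl
  extract-sound {a} (there {b} {w} {r} far ex) =
    ≈-trans (⊗-cong ≈-refl (extract-sound ex)) (≈-sym (commute-front ⟦ r ⟧ far))

  -- If `i` is the first letter of the run, a square appears; if it is one less, the braid word `i`,
  -- `i + 1`, `i`. Otherwise `i` commutes past the first letter into a shorter run.
  inside-reducible : ∀ (i : Fin n) q m {r} (w : Word n) → map toℕ w ≡ descent q (suc m) ++ r →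
                     q ≤ toℕ i → toℕ i ≤ q + m → Reducible (i ∷ w)
  inside-reducible i q m       (j ∷ w) eq q≤i i≤q+m with m≤n⇒m<n∨m≡n i≤q+m | ∷-injective eq
  ... | inj₂ i≡q+m | j≡q+m , _ with toℕ-injective (trans i≡q+m (sym j≡q+m))
  ... | refl = square-reducible i w
  inside-reducible i q zero    (j ∷ w) eq q≤i _ | inj₁ i<q+0 | _ =
    contradiction (≤-trans i<q+0 (≤-reflexive (+-identityʳ q))) (≤⇒≯ q≤i)
  inside-reducible i q (suc m) (j ∷ w) eq q≤i _ | inj₁ i<j | j≡ , eqʷ
    with m≤n⇒m<n∨m≡n (≤-pred (≤-trans i<j (≤-reflexive (+-suc q m))))
  inside-reducible i q (suc m) (j ∷ k ∷ w) eq q≤i _ | inj₁ _ | j≡ , eqʷ | inj₂ i≡q+m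
    with toℕ-injective (trans i≡q+m (sym (proj₁ (∷-injective eqʷ))))
  ... | refl = triple-reducible i j i (x-braid (trans j≡ (trans (+-suc q m) (cong suc (sym i≡q+m)))))
  inside-reducible i q (suc m) (j ∷ w) eq q≤i _ | inj₁ _ | j≡ , eqʷ | inj₁ i<q+m =
    ≈-trans (commute-front {i} {j} ⟦ w ⟧ (apart-below
              (≤-trans (s≤s i<q+m) (≤-reflexive (trans (sym (+-suc q m)) (sym j≡))))))
            (reducible-∷ j (inside-reducible i q m w eqʷ q≤i (<⇒≤ i<q+m)))

  extract-past-descent : ∀ (i : Fin n) q m {r} (w : Word n) →
                         map toℕ w ≡ descent q m ++ toℕ i ∷ r → q + m < toℕ i →
                         ∃ λ r′ → Extract i w r′
  extract-past-descent i q zero    (j ∷ w) eq q+m<i with toℕ-injective (proj₁ (∷-injective eq))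
  ... | refl = w , here
  extract-past-descent i q (suc m) (j ∷ w) eq q+m<i with ∷-injective eq
  ... | j≡ , eqʷ with subst (_< toℕ i) (+-suc q m) q+m<i
  ... | 1+q+m<i with extract-past-descent i q m w eqʷ (<⇒≤ 1+q+m<i)
  ... | r , ex = j ∷ r , there (apart-above (subst (λ t → suc t < toℕ i) (sym j≡) 1+q+m<i)) ex

  -- The second `i` commutes with every letter of the run but the first, which leaves the braid word
  -- `i`, `i - 1`, `i` in front.
  repeat-reducible : ∀ (i : Fin n) q m {r} (w : Word n) →
                     map toℕ w ≡ descent q (suc m) ++ toℕ i ∷ r →
                     toℕ i ≡ suc (q + m) → Reducible (i ∷ w)
  repeat-reducible i q m (j ∷ w) eq i≡ with ∷-injective eq
  ... | j≡ , eqʷ with extract-past-descent i q m w eqʷ (≤-reflexive (sym i≡))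
  ... | r , ex = ≈-trans (⊗-cong ≈-refl (⊗-cong ≈-refl (extract-sound ex)))
                         (triple-reducible i j i (x-braid′ (trans i≡ (cong suc (sym j≡)))))

  -- The letter `i` is compared with the first run of the tail: below the run it starts a new one,
  -- within it gives zero, just above it lengthens the run, and further above it contradicts
  -- minimality.
  monomial-chain : ∀ w → ¬ Reducible w → (∀ v → Equivalent w v → w ≤lex v) →
                   ∃ λ c → Chain 0 0 c × map toℕ w ≡ spell c
  monomial-chain []      irr min = [] , [] , refl
  monomial-chain (i ∷ w) irr min
    with monomial-chain w (λ red → irr (reducible-∷ i red)) (minimal-tail i min)
  ... | [] , [] , eq =
    (toℕ i , 0) ∷ [] , link z≤n z≤n [] , cong₂ _∷_ (sym (+-identityʳ (toℕ i))) eq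
  ... | (q , m) ∷ c , link _ _ ch , eq with <-cmp (toℕ i) (suc (q + m))
  monomial-chain (i ∷ w) irr min | (q , m) ∷ c , link _ _ ch , eq | tri< i≤q+m _ _
    with <-≤-connex (toℕ i) q
  ... | inj₁ i<q = (toℕ i , 0) ∷ (q , m) ∷ c
                 , link z≤n z≤n (link i<q (subst (_≤ suc (q + m)) (+-comm 1 _)
                                            (s≤s (≤-trans i<q (m≤m+n q m)))) ch)
                 , cong₂ _∷_ (sym (+-identityʳ (toℕ i))) eq
  ... | inj₂ q≤i = contradiction (inside-reducible i q m w eq q≤i (≤-pred i≤q+m)) irr
  monomial-chain (i ∷ w) irr min | (q , m) ∷ c , link _ _ ch , eq | tri≈ _ i≡ _ =
    (q , suc m) ∷ c , link z≤n z≤n (lengthen ch eq) , cong₂ _∷_ (trans i≡ (sym (+-suc q m))) eq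
    where
    lengthen : ∀ {c′} → Chain (suc q) (suc m) c′ → map toℕ w ≡ spell ((q , m) ∷ c′) →
               Chain (suc q) (suc (suc m)) c′
    lengthen []                                  _  = []
    lengthen (link {q′} {m′} {c′} q<q′ top<top′ ch) eq =
      link q<q′ (s≤s (subst (_≤ q′ + m′) (sym (trans (+-suc q (suc m)) (cong suc (+-suc q m))))
                            (≤∧≢⇒< top≤ top≢))) ch
      where
      top≤ : suc (q + m) ≤ q′ + m′
      top≤ = subst (_≤ q′ + m′) (+-suc q m) (≤-pred top<top′)
      -- The lengthened run starts at `i`; if the next run started there too, `i` would occur twice
      -- around the old run and give zero.
      top≢ : suc (q + m) ≢ q′ + m′
      top≢ top≡ = irr (repeat-reducible i q m w
        (subst (λ t → map toℕ w ≡ descent q (suc m) ++ t ∷ descent q′ m′ ++ spell c′)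
               (sym (trans i≡ top≡)) eq) i≡)
  monomial-chain (i ∷ j ∷ w) irr min | (q , m) ∷ c , link _ _ ch , eq | tri> _ _ i>
    with subst (λ t → suc t < toℕ i) (sym (proj₁ (∷-injective eq))) i>
  -- The letters `i` and `j` commute, and swapping them puts the smaller one first.
  ... | 1+j<i with min (j ∷ i ∷ w) (swap [] w (apart-above 1+j<i) ◅ ε)
  ... | this i<j   = contradiction i<j (<⇒≯ (<⇒≤ 1+j<i))
  ... | next i≡j _ = contradiction (cong toℕ i≡j) (>⇒≢ (<⇒≤ 1+j<i))

-- Decreasing runs of a concatenation.

++-split : ∀ {A : Set} (as bs cs ds : List A) → as ++ bs ≡ cs ++ ds →
           (∃ λ es → as ≡ cs ++ es × ds ≡ es ++ bs) ⊎
           (∃₂ λ e es → cs ≡ as ++ e ∷ es × bs ≡ e ∷ es ++ ds)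
++-split []       bs []       ds eq = inj₁ ([] , refl , sym eq)
++-split []       bs (c ∷ cs) ds eq = inj₂ (c , cs , refl , eq)
++-split (a ∷ as) bs []       ds eq = inj₁ (a ∷ as , refl , sym eq)
++-split (a ∷ as) bs (c ∷ cs) ds eq with ∷-injective eq
... | refl , eq′ with ++-split as bs cs ds eq′
... | inj₁ (es , refl , eq″)     = inj₁ (es , refl , eq″)
... | inj₂ (e , es , refl , eq″) = inj₂ (e , es , refl , eq″)

-- Comparing first letters is enough to separate runs: a run ends no higher than it begins, and the
-- next one begins higher.
data RunsFrom {n} (l : ℕ) : List (Word n) → Set where
  []   : RunsFrom l []
  cons : ∀ {y ys Rs} → l ≤ toℕ y → Decreasing (y ∷ ys) → RunsFrom (suc (toℕ y)) Rs →
         RunsFrom l ((y ∷ ys) ∷ Rs)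

decreasing-≤head : ∀ {n} {y : Fin n} {ys} → Decreasing (y ∷ ys) → All (λ z → toℕ z ≤ toℕ y) (y ∷ ys)
decreasing-≤head dec with Linked.Linked⇒AllPairs (λ i>j j>k → Fin.<-trans j>k i>j) dec
... | y>ys ∷ _ = ≤-refl ∷ All.map <⇒≤ y>ys

decreasing-pair : ∀ {n} (xs : Word n) {x} ys {z zs} →
                  Decreasing (xs ++ x ∷ ys ++ z ∷ zs) → toℕ z < toℕ x
decreasing-pair []       ys dec with Linked.Linked⇒AllPairs (λ i>j j>k → Fin.<-trans j>k i>j) dec
... | x> ∷ _ = All.head (All.++⁻ʳ ys x>)
decreasing-pair (_ ∷ xs) ys dec = decreasing-pair xs ys (Linked.tail dec)

runs-head : ∀ {n l} {Rs : List (Word n)} {z zs} → RunsFrom l Rs → concat Rs ≡ z ∷ zs → l ≤ toℕ z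
runs-head (cons l≤y _ _) refl = l≤y

runs-drop : ∀ {n l} (Rs : List (Word n)) {Ss} → RunsFrom l (Rs ++ Ss) →
            ∃ λ l′ → l ≤ l′ × RunsFrom l′ Ss × All (λ z → toℕ z < l′) (concat Rs)
runs-drop []              rs = _ , ≤-refl , rs , []
runs-drop ((y ∷ ys) ∷ Rs) (cons l≤y dec rs) with runs-drop Rs rs
... | l′ , y<l′ , rs′ , below =
  l′ , ≤-trans l≤y (<⇒≤ y<l′) , rs′ ,
  All.++⁺ (All.map (λ z≤y → ≤-<-trans z≤y y<l′) (decreasing-≤head dec)) below

-- An extension to the left adds letters below `l′`, hence below `y`; one to the right adds the
-- first letter of the next run, which exceeds `y`.
block⇒decreasingRun : ∀ {n l} {Rss : List (Word n)} {u b v} → RunsFrom l Rss →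
                      (∃₂ λ Rs Ss → Rss ≡ Rs ++ b ∷ Ss × u ≡ concat Rs × v ≡ concat Ss) →
                      IsDecreasingRun (concat Rss) u b v
block⇒decreasingRun rs (Rs , Ss , refl , refl , refl) with runs-drop Rs rs
... | l′ , _ , cons {y} {ys} l′≤y dec rs′ , below = record
  { factor     = concat-++ Rs ((y ∷ ys) ∷ Ss)
  ; nonempty   = λ ()
  ; decreasing = dec
  ; maximal    = λ u′ s t v′ eqᵘ eqᵛ dec′ →
      left s t (All.++⁻ʳ u′ (subst (All _) eqᵘ below)) dec′ , right s t eqᵛ dec′
  }
  where
  left : ∀ s t → All (λ z → toℕ z < l′) s → Decreasing (s ++ (y ∷ ys) ++ t) → s ≡ []
  left []      t _         _   = refl
  left (x ∷ s) t (x< ∷ _) dec′ = contradiction (<-≤-trans x< l′≤y) (<⇒≯ (decreasing-pair [] s dec′))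
  right : ∀ s t {v′} → concat Ss ≡ t ++ v′ → Decreasing (s ++ (y ∷ ys) ++ t) → t ≡ []
  right s []      _  _    = refl
  right s (z ∷ t) eq dec′ = contradiction (runs-head rs′ eq) (<⇒≯ (decreasing-pair s ys dec′))

decreasingRun⇒block : ∀ {n l} {Rs : List (Word n)} {u b v} → RunsFrom l Rs →
                      IsDecreasingRun (concat Rs) u b v →
                      ∃₂ λ Rs′ Ss → Rs ≡ Rs′ ++ b ∷ Ss × u ≡ concat Rs′ × v ≡ concat Ss
decreasingRun⇒block {u = []} {b = []}    [] dr = contradiction refl (IsDecreasingRun.nonempty dr)
decreasingRun⇒block {u = []} {b = _ ∷ _} [] dr with IsDecreasingRun.factor dr
... | ()
decreasingRun⇒block {u = _ ∷ _} [] dr with IsDecreasingRun.factor dr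
... | ()
decreasingRun⇒block {u = u} {b} {v} (cons {y} {ys} {Rs} _ dec rs) dr
  with ++-split u (b ++ v) (y ∷ ys) (concat Rs) (IsDecreasingRun.factor dr)
... | inj₁ (u″ , refl , eq)
  with decreasingRun⇒block rs record
    { factor     = sym eq
    ; nonempty   = nonempty
    ; decreasing = decreasing
    ; maximal    = λ u′ s t v′ eqᵘ → maximal (y ∷ ys ++ u′) s t v′
                     (trans (cong ((y ∷ ys) ++_) eqᵘ) (sym (++-assoc (y ∷ ys) u′ s)))
    }
  where
  open IsDecreasingRun dr
... | Rs′ , Ss , refl , refl , refl = (y ∷ ys) ∷ Rs′ , Ss , refl , refl , refl
decreasingRun⇒block {u = u} {b} {v} (cons {y} {ys} {Rs} _ dec rs) dr
  | inj₂ (e , es , eqᴿ , eqᵇ) with ++-split b v (e ∷ es) (concat Rs) eqᵇ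
... | inj₁ ([] , refl , refl)
  -- Here `b` ends with the first run, and prefixing `u` completes that run, so maximality makes `u`
  -- empty.
  with IsDecreasingRun.maximal dr [] u [] (concat Rs) refl refl
         (subst Decreasing (trans eqᴿ (cong (u ++_) (sym (trans (++-identityʳ _) (++-identityʳ _))))) dec)
... | refl , _ = [] , Rs , cong (_∷ Rs) (trans eqᴿ (sym (++-identityʳ _))) , refl , refl
decreasingRun⇒block {u = u} {b} {v} (cons {y} {ys} {Rs} _ dec rs) dr
  | inj₂ (e , es , eqᴿ , eqᵇ) | inj₁ (z ∷ f , refl , eq) =
  -- Here `b` reaches into the next run, whose first letter `z` exceeds `y` and hence the letter `e`
  -- of `b`.
  contradiction (≤-trans (s≤s e≤y) (runs-head rs eq))
                (<⇒≯ (decreasing-pair [] es (IsDecreasingRun.decreasing dr)))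
  where
  e≤y : toℕ e ≤ toℕ y
  e≤y = All.head (All.++⁻ʳ u (subst (All _) eqᴿ (decreasing-≤head dec)))
decreasingRun⇒block {u = u} {b} {v} (cons {y} {ys} {Rs} _ dec rs) dr
  | inj₂ (e , es , eqᴿ , eqᵇ) | inj₂ (f , fs , eq , refl)
  -- Here `b` stops inside the first run, whose remaining letters would extend it.
  with IsDecreasingRun.maximal dr [] u (f ∷ fs) (concat Rs) refl refl
         (subst Decreasing (trans eqᴿ (cong (u ++_) eq)) dec)
... | _ , ()

decreasingRun⇔block : ∀ {n l} {Rss : List (Word n)} {u b v} → RunsFrom l Rss →
  IsDecreasingRun (concat Rss) u b v ⇔
  (∃₂ λ Rs Ss → Rss ≡ Rs ++ b ∷ Ss × u ≡ concat Rs × v ≡ concat Ss)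
decreasingRun⇔block rs = mk⇔ (decreasingRun⇒block rs) (block⇒decreasingRun rs)

-- Identification of `Φ` with the spelled codes.

descent-decreasing : ∀ q k → Linked _>_ (descent q k)
descent-decreasing q zero          = []
descent-decreasing q (suc zero)    = [-]
descent-decreasing q (suc (suc k)) = ≤-reflexive (sym (+-suc q k)) ∷ descent-decreasing q (suc k)

-- A chain bounds one plus the next first letter, hence `pred`. After the run `(q , m)` the bound
-- `pred (suc q + suc m)` is one more than its first letter `q + m`.
chain-runs : ∀ {n d b c} {Rs : List (Word n)} → Chain d b c →
             map (map toℕ) Rs ≡ map letters c → RunsFrom (pred (d + b)) Rs
chain-runs {Rs = []}            []                         eq = []
chain-runs {Rs = (y ∷ ys) ∷ Rs} (link {q} {m} _ d+b≤ ch) eq with ∷-injective eq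
... | eqᴿ , eqᴿˢ =
  cons (subst (_ ≤_) (sym y≡) (pred-mono-≤ d+b≤))
       (Linked.map⁻ (subst (Linked _>_) (sym eqᴿ) (descent-decreasing q (suc m))))
       (subst (λ l → RunsFrom l Rs) (trans (+-suc q m) (cong suc (sym y≡))) (chain-runs ch eqᴿˢ))
  where
  y≡ : toℕ y ≡ q + m
  y≡ = ∷-injectiveˡ eqᴿ

toℕ-letter : ∀ {n} i .(1≤i : 1 ≤ i) .(i≤n : i ≤ n) → toℕ (letter i 1≤i i≤n) ≡ i ∸ 1
toℕ-letter (suc i) _ i<n = toℕ-fromℕ< i<n

tabulate-descent : ∀ q r → tabulate {n = r} (λ k → q + r ∸ toℕ k ∸ 1) ≡ descent q r
tabulate-descent q zero    = refl
tabulate-descent q (suc r) rewrite +-suc q r = cong (q + r ∷_) (tabulate-descent q r)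

peak-abscissa : ∀ d b → suc (b + 2 * d) + suc b ≡ 2 + 2 * (d + b)
peak-abscissa = solve-∀

topIndex-peak : ∀ d b → topIndex (suc (b + 2 * d) , suc b) ≡ d + b
topIndex-peak d b = trans (cong (λ t → (t ∸ 2) / 2) (peak-abscissa d b)) (double-half (d + b))

map-toℕ-run : ∀ {n a} d b → a ≡ b + 2 * d → (bd : Bounded (2 * suc n) (suc a , suc b)) →
              map toℕ (run (suc a , suc b) bd) ≡ descent d b
map-toℕ-run {a = a} d b refl bd = begin
  map toℕ (run P bd)
    ≡⟨ map-tabulate _ toℕ ⟩
  tabulate {n = b} _
    ≡⟨ tabulate-cong {n = b} (λ k → toℕ-letter (topIndex P ∸ toℕ k) _ _) ⟩
  tabulate {n = b} (λ k → topIndex P ∸ toℕ k ∸ 1)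
    ≡⟨ cong (λ t → tabulate {n = b} (λ k → t ∸ toℕ k ∸ 1)) (topIndex-peak d b) ⟩
  tabulate {n = b} (λ k → d + b ∸ toℕ k ∸ 1)
    ≡⟨ tabulate-descent d b ⟩
  descent d b ∎
  where
  open ≡-Reasoning
  P = suc a , suc b

-- The equation `a ≡ b + 2 * d` ties `d` to the abscissa and turns the formulas for the top index
-- and run length into the code. Splitting on the height after a peak lets the filter compute.
highPeaks-codes : ∀ {n a b} d (p : Path (2 * suc n) a b) → a ≡ b + 2 * d →
                  (bd : All (Bounded (2 * suc n)) (highPeaks p)) →
                  map (map toℕ) (reduce (λ {P} → run P) bd) ≡ map letters (codes d p)
highPeaks-codes d end eq [] = refl
highPeaks-codes d (up (down {b = zero} p)) eq bd =
  highPeaks-codes (suc d) p (trans (cong (2 +_) eq) (down-abscissa 0 d)) bd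
highPeaks-codes d (up (down {b = suc m} p)) eq (bd ∷ bds) =
  cong₂ _∷_ (map-toℕ-run d (suc m) eq bd)
            (highPeaks-codes (suc d) p (trans (cong (2 +_) eq) (down-abscissa (suc m) d)) bds)
highPeaks-codes d (up (up p)) eq bd = highPeaks-codes d (up p) (cong suc eq) bd
highPeaks-codes d (down {b = b} p) eq bd =
  highPeaks-codes (suc d) p (trans (cong suc eq) (down-abscissa b d)) bd

tops-below : ∀ {n} c → All (_< n) (spell c) → All (TopBelow (suc n)) c
tops-below []            _          = []
tops-below ((q , m) ∷ c) (px ∷ pxs) = s≤s px ∷ tops-below c (All.++⁻ʳ (descent q m) pxs)

runs-codes : ∀ n (D : DyckPath (suc n)) → map (map toℕ) (runs n D) ≡ map letters (codes 0 D)
runs-codes n D = highPeaks-codes 0 D refl (highPeaks-bounded D)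

Φ-spell : ∀ n (D : DyckPath (suc n)) → map toℕ (Φ n D) ≡ spell (codes 0 D)
Φ-spell n D = trans (sym (concat-map (runs n D))) (cong concat (runs-codes n D))

theorem4p1 : ∀ {c ℓ} (K : CommutativeRing c ℓ) →
    ¬ (CommutativeRing._≈_ K (CommutativeRing.1# K) (CommutativeRing.0# K)) →
    (n : ℕ) →
    (Σ[ mono ∈ ((D : DyckPath (suc n)) → IsNTLMonomial K n (Φ n D)) ]
    Bijective {A = DyckPath (suc n)} {B = NTLMonomial K n}
    _≡_ (_≡_ on proj₁) (λ D → Φ n D , mono D))
    ×
    ((D : DyckPath (suc n)) (u b v : Word n) →
    IsDecreasingRun (Φ n D) u b v ⇔
    (∃₂ λ Rs Ss → runs n D ≡ Rs ++ b ∷ Ss × u ≡ concat Rs × v ≡ concat Ss))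
theorem4p1 K 1≉0 n = (mono , injective , surjective) , λ D u b v →
  decreasingRun⇔block (chain-runs (codes-chain 0 D) (runs-codes n D))
  where
  mono : (D : DyckPath (suc n)) → IsNTLMonomial K n (Φ n D)
  mono D with chain-hops (codes-chain 0 D)
  ... | s , moves = record
    { irreducible = Particles.hops⇒irreducible K n 1≉0 (Φ n D) {s}
        (trans (cong (λ w → hops w s) (Φ-spell n D)) (proj₂ (moves [] refl)))
    ; minimal     = λ v →
        normal⇒minimal (subst Normal (sym (Φ-spell n D)) (chain-normal (codes-chain 0 D)))
    }

  injective : ∀ {D D′ : DyckPath (suc n)} → Φ n D ≡ Φ n D′ → D ≡ D′
  injective {D} {D′} eq = spell-codes-injective 0 D D′
    (trans (sym (Φ-spell n D)) (trans (cong (map toℕ) eq) (Φ-spell n D′)))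

  surjective : (w : NTLMonomial K n) →
               Σ[ D ∈ DyckPath (suc n) ] (∀ {D′} → D′ ≡ D → Φ n D′ ≡ proj₁ w)
  surjective (w , isMono)
    with Monomials.monomial-chain K n w
           (IsNTLMonomial.irreducible isMono) (IsNTLMonomial.minimal isMono)
  ... | c , ch , eq
    -- The letters of `w` are below `n`, so every run fits a path with `suc n` down steps from the
    -- origin.
    with decode (suc n) 0 0 refl refl z≤n ch
           (tops-below c (subst (All (_< n)) eq (All.map⁺ (All.universal Fin.toℕ<n w))))
  ... | D , refl = D , λ { refl → map-injective toℕ-injective (trans (Φ-spell n D) (sym eq)) }
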